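{- Let $k$ be a positive integer, let $G$ be an $n$-vertex graph, and let $A\in\mathcal{S}(G)$ be a matrix all of whose row sums are equal to a constant $d$. Let $p(x)\in\mathbb{R}_k[x]$ be a polynomial such that $p(A)$ is positive semidefinite and $p(d)>0$. Then $$\alpha_k(G)\leq\frac{n}{p(d)}\max_{u\in V(G)}(p(A))_{uu},$$ $$\vartheta(\overline{G^k})\geq\frac{n\,p(d)}{\mathrm{tr}\,p(A)}.$$
   Context: Graphs are finite, simple, undirected, with nonempty vertex set $V(G)$. $d(i,j)$ denotes the distance between vertices $i$ and $j$ in $G$ (with $d(i,j)=\infty$ if they lie in different components). A $k$-independent set of $G$ is a subset $U\subseteq V(G)$ with $d(i,j)>k$ for any two distinct $i,j\in U$; $\alpha_k(G)$ is the maximum size of a $k$-independent set. The power graph $G^k$ has the same vertices as $G$, two distinct vertices being adjacent iff they are at distance at most $k$ in $G$. $\overline{H}$ denotes the complement of a graph $H$. $\mathbb{R}_k[x]$ is the set of real polynomials of degree at most $k$. $\mathcal{S}(G)$ is the set of real symmetric matrices $A$ indexed by the vertices of $G$ such that $(A)_{ij}=0$ whenever $d(i,j)>1$ (diagonal entries are arbitrary). Lovász theta function: an orthonormal representation of a graph $H$ with vertex set $\{1,\ldots,n\}$ is a set of unit real vectors $\{u_1,\ldots,u_n\}$ (in some Euclidean space) with $u_i^\top u_j=0$ whenever $i,j$ are distinct nonadjacent vertices; its value is $\min_c\max_{1\le i\le n}\frac{1}{(c^\top u_i)^2}$, with $c$ ranging over all unit real vectors; $\vartheta(H)$ is the minimum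 value over all orthonormal representations of $H$. By a theorem of Lovász (1979), which may be taken as known, $\vartheta(H)=\max_B e^\top Be$, where $e$ is the all-ones vector and $B$ ranges over all positive semidefinite real $n\times n$ matrices with $\mathrm{tr}\,B=1$ and $(B)_{ij}=0$ for every $\{i,j\}\in E(H)$. -}

module Defs where

open import Algebra.Bundles using (CommutativeRing)
open import Algebra.Core using (Op₁; Op₂)
open import Algebra.Definitions using (Congruent₁)
open import Algebra.Structures using (IsCommutativeRing)
import Algebra.Construct.NaturalChoice.Max as Max
import Algebra.Definitions.RawMonoid as RawMonoidDefs
import Algebra.Properties.Semiring.Exp as Exp
open import Data.Bool.Base using (if_then_else_)
open import Data.Fin.Base using (Fin; toℕ)
import Data.Fin.Properties as Fin
open import Data.Fin.Subset using (Subset; _∈_; ∣_∣; ⊥)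
open import Data.Fin.Subset.Properties using (_∈?_; anySubset?; ∣p∣≤n; ∉⊥; ∣⊥∣≡0)
open import Data.Nat.Base as ℕ using (ℕ; zero; suc; NonZero)
import Data.Nat.Properties as ℕ
open import Data.Product using (∃; ∃-syntax; Σ-syntax; _×_; _,_; proj₁; proj₂; map₂; map₁)
open import Data.Empty using (⊥-elim)
open import Data.Vec.Functional using (Vector; foldr; head; tail)
open import Level using (_⊔_; 0ℓ) renaming (suc to lsuc)
open import Relation.Binary.Core using (Rel)
open import Relation.Binary.Definitions using (Decidable; Symmetric; Irreflexive)
open import Relation.Binary.Bundles using (DecTotalOrder)
open import Relation.Binary.Structures using (IsDecTotalOrder)
import Relation.Binary.Construct.NonStrictToStrict as NonStrictToStrict
open import Relation.Binary.PropositionalEquality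
  using (_≡_; _≢_; refl; ≢-sym)
open import Relation.Nullary using (¬_; Dec; yes; no; does)
open import Relation.Nullary.Decidable using (map′; ¬?; _×-dec_; _→-dec_)
open import Relation.Unary using (Pred)
import Relation.Unary as Unary

module _ {a ℓ p} {A : Set a} (_≤_ : Rel A ℓ) (P : Pred A p) where

  IsMaximum : A → Set (a ⊔ ℓ ⊔ p)
  IsMaximum x = P x × (∀ y → P y → y ≤ x)

  IsMinimum : A → Set (a ⊔ ℓ ⊔ p)
  IsMinimum x = P x × (∀ y → P y → x ≤ y)

maximumℕ : ∀ {p} {P : Pred ℕ p} → Unary.Decidable P → P 0 →
           ∀ b → (∀ a → P a → a ℕ.≤ b) → ∃ (IsMaximum ℕ._≤_ P)
maximumℕ P? P0 zero    bound = 0 , P0 , bound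
maximumℕ P? P0 (suc b) bound with P? (suc b)
... | yes Pb = suc b , Pb , bound
... | no ¬Pb = maximumℕ P? P0 b λ a Pa →
  ℕ.≤-pred (ℕ.≤∧≢⇒< (bound a Pa) λ { refl → ¬Pb Pa })

record Graph (n : ℕ) : Set₁ where
  field
    Adj     : Rel (Fin n) 0ℓ
    adj?    : Decidable Adj
    symm    : Symmetric Adj
    irrefl  : Irreflexive _≡_ Adj

complement : ∀ {n} → Graph n → Graph n
complement H = record
  { Adj    = λ i j → i ≢ j × ¬ Adj i j
  ; adj?   = λ i j → ¬? (i Fin.≟ j) ×-dec ¬? (adj? i j)
  ; symm   = λ (i≢j , ¬ij) → ≢-sym i≢j , λ ji → ¬ij (symm ji)
  ; irrefl = λ i≡j (i≢j , _) → i≢j i≡j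
  }
  where open Graph H

module _ {n} (G : Graph n) where
  open Graph G

  -- Walk m i j : a walk with m edges from i to j.
  data Walk : ℕ → Rel (Fin n) 0ℓ where
    []  : ∀ {i} → Walk 0 i i
    _∷_ : ∀ {m i j l} → Adj i j → Walk m j l → Walk (suc m) i l

  -- The distance is the least length of a walk, and infinite if there is no
  -- walk; hence it is at most k iff some walk has length at most k.
  d⟨_,_⟩≤_ : Fin n → Fin n → ℕ → Set
  d⟨ i , j ⟩≤ k = ∃[ m ] m ℕ.≤ k × Walk m i j

  d⟨_,_⟩>_ : Fin n → Fin n → ℕ → Set
  d⟨ i , j ⟩> k = ¬ d⟨ i , j ⟩≤ k

  private
    walk? : ∀ m → Decidable (Walk m)
    walk? zero    i j = map′ (λ { refl → [] }) (λ { [] → refl }) (i Fin.≟ j)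
    walk? (suc m) i l = map′ (λ (_ , a , w) → a ∷ w) (λ { (a ∷ w) → _ , a , w })
      (Fin.any? λ j → adj? i j ×-dec walk? m j l)

    snoc : ∀ {m i j l} → Walk m i j → Adj j l → Walk (suc m) i l
    snoc []      b = b ∷ []
    snoc (a ∷ w) b = a ∷ snoc w b

    reverse : ∀ {m i j} → Walk m i j → Walk m j i
    reverse []      = []
    reverse (a ∷ w) = snoc (reverse w) (symm a)

  d≤? : ∀ i j k → Dec (d⟨ i , j ⟩≤ k)
  d≤? i j k = map′ (map₂ (map₁ ℕ.≤-pred)) (map₂ (map₁ ℕ.s≤s))
    (ℕ.anyUpTo? (λ m → walk? m i j) (suc k))

  power : ℕ → Graph n
  power k = record
    { Adj    = λ i j → i ≢ j × d⟨ i , j ⟩≤ k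
    ; adj?   = λ i j → ¬? (i Fin.≟ j) ×-dec d≤? i j k
    ; symm   = λ (i≢j , m , m≤k , w) → ≢-sym i≢j , m , m≤k , reverse w
    ; irrefl = λ i≡j (i≢j , _) → i≢j i≡j
    }

  Independent : ℕ → Subset n → Set
  Independent k U = ∀ i j → i ∈ U → j ∈ U → i ≢ j → d⟨ i , j ⟩> k

  IndependentSize : ℕ → Pred ℕ 0ℓ
  IndependentSize k a = ∃[ U ] Independent k U × ∣ U ∣ ≡ a

  private
    independent? : ∀ k U → Dec (Independent k U)
    independent? k U = Fin.all? λ i → Fin.all? λ j →
      (i ∈? U) →-dec ((j ∈? U) →-dec (¬? (i Fin.≟ j) →-dec ¬? (d≤? i j k)))

  maxIndependentSize : ∀ k → ∃ (IsMaximum ℕ._≤_ (IndependentSize k))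
  maxIndependentSize k = maximumℕ
    (λ a → anySubset? λ U → independent? k U ×-dec (∣ U ∣ ℕ.≟ a))
    (⊥ , (λ _ _ i∈⊥ → ⊥-elim (∉⊥ i∈⊥)) , ∣⊥∣≡0 n)
    n (λ { _ (U , _ , refl) → ∣p∣≤n U })

  α : ℕ → ℕ
  α k = proj₁ (maxIndependentSize k)

-- The field of real numbers is characterised, up to unique isomorphism, as the
-- Dedekind-complete ordered field.  Equality is the setoid equality _≈_, and
-- the order is decidable, as it is classically.
record CompleteOrderedField c ℓ₁ ℓ₂ : Set (lsuc (c ⊔ ℓ₁ ⊔ ℓ₂)) where
  infix  8 -_
  infix  9 _⁻¹
  infixl 7 _*_ _/_
  infixl 6 _+_
  infix  4 _≈_ _≤_
  field
    Carrier           : Set c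
    _≈_               : Rel Carrier ℓ₁
    _≤_               : Rel Carrier ℓ₂
    _+_ _*_           : Op₂ Carrier
    -_                : Op₁ Carrier
    0# 1#             : Carrier
    -- Total; nothing is said about the value of 0# ⁻¹.
    _⁻¹               : Op₁ Carrier
    isCommutativeRing : IsCommutativeRing _≈_ _+_ _*_ -_ 0# 1#
    1≉0               : ¬ 1# ≈ 0#
    ⁻¹-cong           : Congruent₁ _≈_ _⁻¹
    ⁻¹-inverseʳ       : ∀ x → ¬ x ≈ 0# → x * x ⁻¹ ≈ 1#
    isDecTotalOrder   : IsDecTotalOrder _≈_ _≤_
    +-monoˡ-≤         : ∀ z {x y} → x ≤ y → x + z ≤ y + z
    *-nonneg          : ∀ {x y} → 0# ≤ x → 0# ≤ y → 0# ≤ x * y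

  UpperBound : Pred Carrier (c ⊔ ℓ₁ ⊔ ℓ₂) → Pred Carrier (c ⊔ ℓ₁ ⊔ ℓ₂)
  UpperBound S b = ∀ x → S x → x ≤ b

  field
    supremum : (S : Pred Carrier (c ⊔ ℓ₁ ⊔ ℓ₂)) → ∃ S → ∃ (UpperBound S) →
               ∃ (IsMinimum _≤_ (UpperBound S))

  commutativeRing : CommutativeRing c ℓ₁
  commutativeRing = record { isCommutativeRing = isCommutativeRing }

  decTotalOrder : DecTotalOrder c ℓ₁ ℓ₂
  decTotalOrder = record { isDecTotalOrder = isDecTotalOrder }

  open NonStrictToStrict _≈_ _≤_ public using (_<_)

  _/_ : Op₂ Carrier
  x / y = x * y ⁻¹

module RealMatrices {c ℓ₁ ℓ₂} (ℝ : CompleteOrderedField c ℓ₁ ℓ₂) where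
  open CompleteOrderedField ℝ
  private module R = CommutativeRing commutativeRing
  open RawMonoidDefs R.+-rawMonoid public using (sum) renaming (_×_ to _·_)
  open Exp R.semiring public using (_^_)
  private module ⊔ = Max (DecTotalOrder.totalOrder decTotalOrder)

  fromℕ : ℕ → Carrier
  fromℕ n = n · 1#

  max : ∀ {n} .{{_ : NonZero n}} → Vector Carrier n → Carrier
  max {suc _} x = foldr ⊔._⊔_ (head x) (tail x)

  ⟨_,_⟩ : ∀ {n} → Vector Carrier n → Vector Carrier n → Carrier
  ⟨ x , y ⟩ = sum λ i → x i * y i

  Matrix : ℕ → Set c
  Matrix n = Fin n → Fin n → Carrier

  identity : ∀ {n} → Matrix n
  identity i j = if does (i Fin.≟ j) then 1# else 0#

  _*ᴹ_ : ∀ {n} → Op₂ (Matrix n)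
  (A *ᴹ B) i j = sum λ l → A i l * B l j

  _^ᴹ_ : ∀ {n} → Matrix n → ℕ → Matrix n
  A ^ᴹ zero  = identity
  A ^ᴹ suc m = A *ᴹ (A ^ᴹ m)

  tr : ∀ {n} → Matrix n → Carrier
  tr A = sum λ i → A i i

  SymmetricMatrix : ∀ {n} → Matrix n → Set ℓ₁
  SymmetricMatrix A = ∀ i j → A i j ≈ A j i

  PositiveSemidefinite : ∀ {n} → Matrix n → Set (c ⊔ ℓ₁ ⊔ ℓ₂)
  PositiveSemidefinite {n} A = SymmetricMatrix A ×
    ((x : Vector Carrier n) → 0# ≤ ⟨ x , (λ i → ⟨ A i , x ⟩) ⟩)

  RowSums : ∀ {n} → Matrix n → Carrier → Set ℓ₁
  RowSums A d = ∀ i → sum (A i) ≈ d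

  𝒮 : ∀ {n} → Graph n → Pred (Matrix n) ℓ₁
  𝒮 G A = SymmetricMatrix A × (∀ i j → d⟨_,_⟩>_ G i j 1 → A i j ≈ 0#)

  -- The polynomials of degree at most k, given by the coefficients of
  -- x⁰, …, xᵏ (the leading ones may vanish).
  Polynomial≤ : ℕ → Set c
  Polynomial≤ k = Vector Carrier (suc k)

  eval : ∀ {k} → Polynomial≤ k → Carrier → Carrier
  eval p x = sum λ i → p i * x ^ toℕ i

  evalᴹ : ∀ {k n} → Polynomial≤ k → Matrix n → Matrix n
  evalᴹ p A u v = sum λ i → p i * (A ^ᴹ toℕ i) u v

  Unit : ∀ {m} → Pred (Vector Carrier m) ℓ₁
  Unit x = ⟨ x , x ⟩ ≈ 1#

  record OrthonormalRep {n} (H : Graph n) (m : ℕ) : Set (c ⊔ ℓ₁) where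
    open Graph H
    field
      vec        : Fin n → Vector Carrier m
      unit       : ∀ i → Unit (vec i)
      orthogonal : ∀ i j → i ≢ j → ¬ Adj i j → ⟨ vec i , vec j ⟩ ≈ 0#

  module _ {n} .{{_ : NonZero n}} where

    -- The numbers maxᵢ 1/(cᵀuᵢ)² with c a unit vector.  If cᵀuᵢ = 0 for some i
    -- then the maximum is infinite and c is irrelevant for the minimum.
    Cost : ∀ {m} → (Fin n → Vector Carrier m) → Pred Carrier (c ⊔ ℓ₁)
    Cost {m} u r = Σ[ c ∈ Vector Carrier m ]
      Unit c × (∀ i → ¬ ⟨ c , u i ⟩ ≈ 0#) × r ≈ max (λ i → 1# / ⟨ c , u i ⟩ ^ 2)

    IsValue : ∀ {H : Graph n} {m} → OrthonormalRep H m → Pred Carrier (c ⊔ ℓ₁ ⊔ ℓ₂)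
    IsValue u = IsMinimum _≤_ (Cost (OrthonormalRep.vec u))

    -- Is-ϑ H t : the Lovász theta function of H is t.
    Is-ϑ : Graph n → Pred Carrier (c ⊔ ℓ₁ ⊔ ℓ₂)
    Is-ϑ H = IsMinimum _≤_ λ v → ∃[ m ] Σ[ u ∈ OrthonormalRep H m ] IsValue u v

{-# OPTIONS --safe #-}

-- Write M = p(A).  It vanishes at pairs at distance more than k, and all its
-- row sums are p(d).
--
-- For the first bound, let χ be the indicator vector of a k-independent set of
-- size α.  Then χᵀMχ is a sum of α diagonal entries of M, while nonnegativity
-- of the quadratic form at nχ − αe gives p(d) α² ≤ n χᵀMχ.
--
-- For the second, only the easy direction of Lovász duality is needed.  Given
-- an orthonormal representation u with handle c, put wᵢ = c − uᵢ/(cᵀuᵢ).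
-- Wherever M does not vanish, wᵢᵀwⱼ = [i = j]/(cᵀuᵢ)² − 1, so Σ Mᵢⱼ wᵢᵀwⱼ ≥ 0
-- reads n p(d) = Σ Mᵢⱼ ≤ Σ Mᵢᵢ/(cᵀuᵢ)² ≤ (tr M) maxᵢ 1/(cᵀuᵢ)².
module Submission where

open import Defs
open import Algebra.Bundles using (CommutativeRing)
import Algebra.Construct.NaturalChoice.Max as Max
import Algebra.Properties.Ring as RingProperties
import Algebra.Properties.Semiring.Sum as Sum
import Algebra.Solver.Ring.NaturalCoefficients.Default as Solver
open import Data.Bool.Base using (if_then_else_; true; false)
open import Data.Fin.Base using (Fin; zero; suc; toℕ)
open import Data.Fin.Properties using (_≟_; toℕ≤pred[n])
open import Data.Fin.Subset using (Subset; ∣_∣)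
open import Data.Nat.Base as ℕ using (ℕ; zero; suc; z≤n; s≤s; NonZero)
import Data.Nat.Properties as ℕ
open import Data.Product using (_×_; _,_; proj₁; proj₂)
open import Data.Sum.Base using (inj₁; inj₂)
open import Data.Vec.Base using ([]; _∷_; lookup)
open import Data.Vec.Functional using (Vector; foldr)
open import Data.Vec.Properties using (lookup⇒[]=)
open import Relation.Binary.Bundles using (DecTotalOrder)
import Relation.Binary.Reasoning.PartialOrder as PartialOrderReasoning
import Relation.Binary.Reasoning.Setoid as SetoidReasoning
open import Relation.Binary.PropositionalEquality as ≡ using (_≡_; _≢_)
open import Relation.Nullary using (¬_; yes; no; contradiction)

module _ {c ℓ₁ ℓ₂} (ℝ : CompleteOrderedField c ℓ₁ ℓ₂) where
  open CompleteOrderedField ℝ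
  open RealMatrices ℝ

  private
    module R = CommutativeRing commutativeRing
    module O = DecTotalOrder decTotalOrder
    module ⊔ = Max O.totalOrder
  open R using (refl; sym; trans; +-cong; +-congˡ; +-congʳ; *-cong; *-congˡ; *-congʳ)
  open RingProperties R.ring using (-‿distribˡ-*; -‿involutive)
  open Sum R.semiring using
    (sum-cong-≋; sum-replicate-zero; ∑-distrib-+; ∑-comm; *-distribˡ-sum; *-distribʳ-sum)
  open Solver R.commutativeSemiring using (solve; _:=_; _:+_; _:*_; con)
  module ≈R = SetoidReasoning R.setoid
  module ≤R = PartialOrderReasoning O.poset

  -- Arithmetic in an ordered field.

  +-mono-≤ : ∀ {x y u v} → x ≤ y → u ≤ v → x + u ≤ y + v
  +-mono-≤ {x} {y} {u} {v} x≤y u≤v = begin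
    x + u ≤⟨ +-monoˡ-≤ u x≤y ⟩
    y + u ≈⟨ R.+-comm y u ⟩
    u + y ≤⟨ +-monoˡ-≤ y u≤v ⟩
    v + y ≈⟨ R.+-comm v y ⟩
    y + v ∎
    where open ≤R

  *-monoˡ-≤ : ∀ {x y z} → 0# ≤ z → x ≤ y → x * z ≤ y * z
  *-monoˡ-≤ {x} {y} {z} 0≤z x≤y = begin
    x * z                   ≈⟨ R.+-identityˡ _ ⟨
    0# + x * z              ≤⟨ +-monoˡ-≤ (x * z) (*-nonneg 0≤y-x 0≤z) ⟩
    -- Only semiring identities are normalised, so `- x` enters as a separate variable `x′`; the
    -- factor `x′ + x` is cancelled afterwards.
    (y + - x) * z + x * z   ≈⟨ solve 4 (λ x x′ y z → (y :+ x′) :* z :+ x :* z := y :* z :+ (x′ :+ x) :* z) refl x (- x) y z ⟩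
    y * z + (- x + x) * z   ≈⟨ +-congˡ (*-congʳ (R.-‿inverseˡ x)) ⟩
    y * z + 0# * z          ≈⟨ +-congˡ (R.zeroˡ z) ⟩
    y * z + 0#              ≈⟨ R.+-identityʳ _ ⟩
    y * z                   ∎
    where
    open ≤R
    0≤y-x : 0# ≤ y + - x
    0≤y-x = O.trans (O.reflexive (sym (R.-‿inverseʳ x))) (+-monoˡ-≤ (- x) x≤y)

  *-cancelʳ : ∀ {x y z} → ¬ z ≈ 0# → x * z ≈ y * z → x ≈ y
  *-cancelʳ {x} {y} {z} z≉0 xz≈yz = begin
    x              ≈⟨ expand x ⟩
    x * z * z ⁻¹   ≈⟨ *-congʳ xz≈yz ⟩
    y * z * z ⁻¹   ≈⟨ expand y ⟨
    y              ∎
    where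
    open ≈R
    expand : ∀ t → t ≈ t * z * z ⁻¹
    expand t = sym (trans (R.*-assoc t z _) (trans (*-congˡ (⁻¹-inverseʳ z z≉0)) (R.*-identityʳ t)))

  -- By totality only the case `y ≤ x` needs an argument; there monotonicity forces the two products
  -- to be equal, and `z` cancels.
  *-cancelʳ-≤ : ∀ {x y z} → 0# < z → x * z ≤ y * z → x ≤ y
  *-cancelʳ-≤ {x} {y} (0≤z , 0≉z) xz≤yz with O.total x y
  ... | inj₁ x≤y = x≤y
  ... | inj₂ y≤x = O.reflexive (*-cancelʳ (λ z≈0 → 0≉z (sym z≈0)) (O.antisym xz≤yz (*-monoˡ-≤ 0≤z y≤x)))

  *-pos : ∀ {x y} → 0# < x → 0# < y → 0# < x * y
  *-pos {x} {y} (0≤x , 0≉x) (0≤y , 0≉y) = *-nonneg 0≤x 0≤y , λ 0≈xy →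
    0≉x (*-cancelʳ (λ y≈0 → 0≉y (sym y≈0)) (trans (R.zeroˡ y) 0≈xy))

  x/y*y≈x : ∀ x {y} → 0# < y → x / y * y ≈ x
  x/y*y≈x x {y} (_ , 0≉y) = begin
    x * y ⁻¹ * y   ≈⟨ solve 3 (λ x y z → x :* z :* y := x :* (y :* z)) refl x y (y ⁻¹) ⟩
    x * (y * y ⁻¹) ≈⟨ *-congˡ (⁻¹-inverseʳ y (λ y≈0 → 0≉y (sym y≈0))) ⟩
    x * 1#         ≈⟨ R.*-identityʳ x ⟩
    x              ∎
    where open ≈R

  -1*-1≈1 : - 1# * - 1# ≈ 1#
  -1*-1≈1 = trans (sym (-‿distribˡ-* 1# (- 1#))) (trans (R.-‿cong (R.*-identityˡ _)) (-‿involutive 1#))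

  0≤1 : 0# ≤ 1#
  0≤1 with O.total 0# 1#
  ... | inj₁ 0≤1 = 0≤1
  -- If 1 ≤ 0 then -1 is nonnegative, hence so is its square, which is 1.
  ... | inj₂ 1≤0 = O.trans (*-nonneg 0≤-1 0≤-1) (O.reflexive -1*-1≈1)
    where
    open ≤R
    0≤-1 : 0# ≤ - 1#
    0≤-1 = begin
      0#         ≈⟨ R.-‿inverseʳ 1# ⟨
      1# + - 1#  ≤⟨ +-monoˡ-≤ (- 1#) 1≤0 ⟩
      0# + - 1#  ≈⟨ R.+-identityˡ _ ⟩
      - 1#       ∎

  fromℕ-nonneg : ∀ n → 0# ≤ fromℕ n
  fromℕ-nonneg zero    = O.refl
  fromℕ-nonneg (suc n) =
    O.trans (O.reflexive (sym (R.+-identityˡ 0#))) (+-mono-≤ 0≤1 (fromℕ-nonneg n))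

  fromℕ-pos : ∀ n .{{_ : NonZero n}} → 0# < fromℕ n
  fromℕ-pos (suc n) = fromℕ-nonneg (suc n) , λ 0≈n → 1≉0 (O.antisym (1≤0 0≈n) 0≤1)
    where
    open ≤R
    1≤0 : 0# ≈ fromℕ (suc n) → 1# ≤ 0#
    1≤0 0≈n = begin
      1#            ≈⟨ R.+-identityʳ 1# ⟨
      1# + 0#       ≤⟨ +-mono-≤ O.refl (fromℕ-nonneg n) ⟩
      fromℕ (suc n) ≈⟨ 0≈n ⟨
      0#            ∎

  -- Finite sums and maxima.

  sum-const : ∀ n x → sum {n} (λ _ → x) ≈ fromℕ n * x
  sum-const zero    x = sym (R.zeroˡ x)
  sum-const (suc n) x =
    trans (+-cong (sym (R.*-identityˡ x)) (sum-const n x)) (sym (R.distribʳ x 1# (fromℕ n)))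

  sum-zero : ∀ {n} {x : Vector Carrier n} → (∀ i → x i ≈ 0#) → sum x ≈ 0#
  sum-zero {n} x≈0 = trans (sum-cong-≋ x≈0) (sum-replicate-zero n)

  sum-mono-≤ : ∀ {n} {x y : Vector Carrier n} → (∀ i → x i ≤ y i) → sum x ≤ sum y
  sum-mono-≤ {zero}  x≤y = O.refl
  sum-mono-≤ {suc n} x≤y = +-mono-≤ (x≤y zero) (sum-mono-≤ (λ i → x≤y (suc i)))

  sum-nonneg : ∀ {n} {x : Vector Carrier n} → (∀ i → 0# ≤ x i) → 0# ≤ sum x
  sum-nonneg {n} 0≤x = O.trans (O.reflexive (sym (sum-replicate-zero n))) (sum-mono-≤ 0≤x)

  -- A factor `identity i j` is how terms concentrated on the diagonal are written below, and this
  -- collapses their sums. It also serves to evaluate at standard basis vectors, which are the rows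
  -- of `identity`.
  sum-identity : ∀ {n} i (x : Vector Carrier n) → sum (λ j → identity i j * x j) ≈ x i
  sum-identity zero x = begin
    1# * x zero + sum (λ j → 0# * x (suc j)) ≈⟨ +-cong (R.*-identityˡ _) (sum-zero (λ j → R.zeroˡ (x (suc j)))) ⟩
    x zero + 0#                              ≈⟨ R.+-identityʳ _ ⟩
    x zero                                   ∎
    where open ≈R
  sum-identity (suc i) x =
    trans (+-cong (R.zeroˡ _) (sum-identity i (λ j → x (suc j)))) (R.+-identityˡ _)

  identity-off-diagonal : ∀ {n} {i j : Fin n} → i ≢ j → identity i j ≈ 0#
  identity-off-diagonal {i = i} {j} i≢j with i ≟ j
  ... | yes i≡j = contradiction i≡j i≢j
  ... | no  _   = refl

  -- `max` folds over the tail starting from the head, so entry `zero` is bounded through the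
  -- starting value of the fold.
  foldr-⊔-base : ∀ {n} b (x : Vector Carrier n) → b ≤ foldr ⊔._⊔_ b x
  foldr-⊔-base {zero}  b x = O.refl
  foldr-⊔-base {suc n} b x = O.trans (foldr-⊔-base b (λ i → x (suc i))) (⊔.x≤y⊔x (x zero) _)

  foldr-⊔-upper : ∀ {n} b (x : Vector Carrier n) i → x i ≤ foldr ⊔._⊔_ b x
  foldr-⊔-upper b x zero    = ⊔.x≤x⊔y (x zero) _
  foldr-⊔-upper b x (suc i) = O.trans (foldr-⊔-upper b (λ i → x (suc i)) i) (⊔.x≤y⊔x (x zero) _)

  max-upper : ∀ {n} .{{_ : NonZero n}} (x : Vector Carrier n) i → x i ≤ max x
  max-upper {suc n} x zero    = foldr-⊔-base (x zero) (λ i → x (suc i))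
  max-upper {suc n} x (suc i) = foldr-⊔-upper (x zero) (λ i → x (suc i)) i

  max-nonneg : ∀ {n} .{{_ : NonZero n}} {x : Vector Carrier n} → (∀ i → 0# ≤ x i) → 0# ≤ max x
  max-nonneg {suc n} {x = x} 0≤x = O.trans (0≤x zero) (max-upper x zero)

  -- Quadratic forms of positive semidefinite matrices.

  quadraticForm : ∀ {n} → Matrix n → Vector Carrier n → Carrier
  quadraticForm M x = ⟨ x , (λ i → ⟨ M i , x ⟩) ⟩

  quadraticForm-expand : ∀ {n} (M : Matrix n) x →
    quadraticForm M x ≈ sum λ i → sum λ j → M i j * (x i * x j)
  quadraticForm-expand M x = sum-cong-≋ λ i →
    trans (*-distribˡ-sum (x i) (λ j → M i j * x j))
      (sum-cong-≋ λ j → solve 3 (λ x m y → x :* (m :* y) := m :* (x :* y)) refl (x i) (M i j) (x j))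

  -- Coordinate by coordinate: the double sum is the sum over `l` of the form of `M` at the vector
  -- of `l`-th coordinates of the `w i`. It is the trace of `M` times the Gram matrix of `w`.
  gram-nonneg : ∀ {n m} {M : Matrix n} → PositiveSemidefinite M → (w : Fin n → Vector Carrier m) →
    0# ≤ sum λ i → sum λ j → M i j * ⟨ w i , w j ⟩
  gram-nonneg {n} {m} {M} (_ , psd) w = begin
    0#                                                          ≤⟨ sum-nonneg (λ l → psd (λ i → w i l)) ⟩
    (sum λ l → quadraticForm M (λ i → w i l))                   ≈⟨ sum-cong-≋ (λ l → quadraticForm-expand M (λ i → w i l)) ⟩
    (sum λ l → sum λ i → sum λ j → M i j * (w i l * w j l))     ≈⟨ ∑-comm {m} {n} _ ⟩
    (sum λ i → sum λ l → sum λ j → M i j * (w i l * w j l))     ≈⟨ sum-cong-≋ (λ i → ∑-comm {m} {n} (λ l j → M i j * (w i l * w j l))) ⟩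
    (sum λ i → sum λ j → sum λ l → M i j * (w i l * w j l))     ≈⟨ sum-cong-≋ (λ i → sum-cong-≋ λ j → *-distribˡ-sum (M i j) (λ l → w i l * w j l)) ⟨
    (sum λ i → sum λ j → M i j * ⟨ w i , w j ⟩)                 ∎
    where open ≤R

  -- The form is evaluated at the standard basis vector of `u`, given as row `u` of `identity`.
  diagonal-nonneg : ∀ {n} {M : Matrix n} → PositiveSemidefinite M → ∀ u → 0# ≤ M u u
  diagonal-nonneg {M = M} (_ , psd) u = begin
    0#                                            ≤⟨ psd (identity u) ⟩
    quadraticForm M (identity u)                  ≈⟨ sum-identity u _ ⟩
    (sum λ j → M u j * identity u j)              ≈⟨ sum-cong-≋ (λ j → R.*-comm (M u j) _) ⟩
    (sum λ j → identity u j * M u j)              ≈⟨ sum-identity u (M u) ⟩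
    M u u                                         ∎
    where open ≤R

  -- Exchanging the sums produces column sums, which symmetry turns into row sums: the all-ones
  -- vector is also a left eigenvector.
  sum-mulVec : ∀ {n} {M : Matrix n} {s} → SymmetricMatrix M → RowSums M s →
    ∀ x → (sum λ i → ⟨ M i , x ⟩) ≈ s * sum x
  sum-mulVec {n} {M} {s} M-sym rows x = begin
    (sum λ i → sum λ j → M i j * x j)   ≈⟨ ∑-comm {n} {n} _ ⟩
    (sum λ j → sum λ i → M i j * x j)   ≈⟨ sum-cong-≋ (λ j → sym (*-distribʳ-sum (x j) (λ i → M i j))) ⟩
    (sum λ j → sum (λ i → M i j) * x j) ≈⟨ sum-cong-≋ (λ j → *-congʳ (trans (sum-cong-≋ (λ i → M-sym i j)) (rows j))) ⟩
    (sum λ j → s * x j)                 ≈⟨ *-distribˡ-sum s x ⟨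
    s * sum x                           ∎
    where open ≈R

  -- Nonnegativity of the quadratic form at n x − (Σ x) e.
  quadraticForm-lower : ∀ {n} .{{_ : NonZero n}} {M : Matrix n} {s} →
    PositiveSemidefinite M → RowSums M s →
    ∀ x → s * (sum x * sum x) ≤ fromℕ n * quadraticForm M x
  quadraticForm-lower {n} {M} {s} (M-sym , psd) rows x =
    -- The form at `y` equals N (N Q - s σ²), so the claim first appears multiplied by `N`, which is
    -- positive.
    *-cancelʳ-≤ (fromℕ-pos n) (begin
      s * (σ * σ) * N                                 ≈⟨ R.+-identityˡ _ ⟨
      0# + s * (σ * σ) * N                            ≤⟨ +-monoˡ-≤ _ (psd y) ⟩
      quadraticForm M y + s * (σ * σ) * N             ≈⟨ +-congʳ expansion ⟩
      N * N * Q + N * τ * (s * σ) + (s * τ * (N * σ) + N * (s * τ * τ)) + s * (σ * σ) * N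
        -- With `τ` kept as a variable for `- σ`, everything except `N * Q * N` adds up to N s (σ +
        -- τ)², which is zero.
        ≈⟨ solve 5 (λ N Q s σ τ →
             N :* N :* Q :+ N :* τ :* (s :* σ) :+ (s :* τ :* (N :* σ) :+ N :* (s :* τ :* τ)) :+ s :* (σ :* σ) :* N
             := N :* Q :* N :+ (N :* s :* (σ :+ τ)) :* (σ :+ τ)) refl N Q s σ τ ⟩
      N * Q * N + N * s * (σ + τ) * (σ + τ)           ≈⟨ +-congˡ (*-congˡ (R.-‿inverseʳ σ)) ⟩
      N * Q * N + N * s * (σ + τ) * 0#                ≈⟨ +-congˡ (R.zeroʳ _) ⟩
      N * Q * N + 0#                                  ≈⟨ R.+-identityʳ _ ⟩
      N * Q * N                                       ∎)
    where
    open ≤R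
    N = fromℕ n
    σ = sum x
    τ = - σ
    Q = quadraticForm M x
    y : Vector Carrier n
    y i = N * x i + τ
    mulVec-y : ∀ i → ⟨ M i , y ⟩ ≈ N * ⟨ M i , x ⟩ + s * τ
    mulVec-y i = ≈R.begin
      (sum λ j → M i j * (N * x j + τ))                     ≈R.≈⟨ sum-cong-≋ (λ j → solve 4 (λ m N x τ →
                                                                  m :* (N :* x :+ τ) := N :* (m :* x) :+ m :* τ) refl (M i j) N (x j) τ) ⟩
      (sum λ j → N * (M i j * x j) + M i j * τ)             ≈R.≈⟨ ∑-distrib-+ (λ j → N * (M i j * x j)) (λ j → M i j * τ) ⟩
      (sum λ j → N * (M i j * x j)) + (sum λ j → M i j * τ) ≈R.≈⟨ +-cong (*-distribˡ-sum N (λ j → M i j * x j)) (*-distribʳ-sum τ (M i)) ⟨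
      N * ⟨ M i , x ⟩ + sum (M i) * τ                       ≈R.≈⟨ +-congˡ (*-congʳ (rows i)) ⟩
      N * ⟨ M i , x ⟩ + s * τ                               ≈R.∎
    expansion : quadraticForm M y ≈ N * N * Q + N * τ * (s * σ) + (s * τ * (N * σ) + N * (s * τ * τ))
    expansion = ≈R.begin
      (sum λ i → y i * ⟨ M i , y ⟩)
        ≈R.≈⟨ sum-cong-≋ (λ i → trans (*-congˡ (mulVec-y i)) (solve 5 (λ N x τ s m →
               (N :* x :+ τ) :* (N :* m :+ s :* τ)
               := (N :* N :* (x :* m) :+ N :* τ :* m) :+ (N :* s :* τ :* x :+ s :* τ :* τ))
               refl N (x i) τ s ⟨ M i , x ⟩)) ⟩
      (sum λ i → (N * N * (x i * ⟨ M i , x ⟩) + N * τ * ⟨ M i , x ⟩) + (N * s * τ * x i + s * τ * τ))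
        ≈R.≈⟨ trans (∑-distrib-+ {n} _ _) (+-cong (∑-distrib-+ {n} _ _) (∑-distrib-+ {n} _ _)) ⟩
      (sum λ i → N * N * (x i * ⟨ M i , x ⟩)) + (sum λ i → N * τ * ⟨ M i , x ⟩)
        + ((sum λ i → N * s * τ * x i) + (sum {n} λ _ → s * τ * τ))
        ≈R.≈⟨ +-cong (+-cong (*-distribˡ-sum {n} _ _) (*-distribˡ-sum {n} _ _)) (+-congʳ (*-distribˡ-sum {n} _ _)) ⟨
      N * N * Q + N * τ * (sum λ i → ⟨ M i , x ⟩) + (N * s * τ * σ + (sum {n} λ _ → s * τ * τ))
        ≈R.≈⟨ +-cong (+-congˡ (*-congˡ (sum-mulVec M-sym rows x)))
               (+-cong (solve 4 (λ N s τ σ → N :* s :* τ :* σ := s :* τ :* (N :* σ)) refl N s τ σ) (sum-const n _)) ⟩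
      N * N * Q + N * τ * (s * σ) + (s * τ * (N * σ) + N * (s * τ * τ)) ≈R.∎

  -- Indicator vectors and the bound on independent sets.

  indicator : ∀ {n} → Subset n → Vector Carrier n
  indicator U i = if lookup U i then 1# else 0#

  indicator-nonneg : ∀ {n} (U : Subset n) i → 0# ≤ indicator U i
  indicator-nonneg U i with lookup U i
  ... | true  = 0≤1
  ... | false = O.refl

  sum-indicator : ∀ {n} (U : Subset n) → sum (indicator U) ≈ fromℕ ∣ U ∣
  sum-indicator []          = refl
  sum-indicator (true  ∷ U) = +-congˡ (sum-indicator U)
  sum-indicator (false ∷ U) = trans (R.+-identityˡ _) (sum-indicator U)

  -- The only link between matrix and graph used in the two bounds; for `k` equal to 1 it is the
  -- zero pattern required by `𝒮`.
  VanishesBeyond : ∀ {n} → Graph n → ℕ → Matrix n → Set ℓ₁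
  VanishesBeyond G k M = ∀ i j → d⟨_,_⟩>_ G i j k → M i j ≈ 0#

  -- Off the diagonal, a nonzero product of indicators means two distinct members of `U`, and `M` is
  -- zero there. On the diagonal the indicator is idempotent.
  quadraticForm-indicator : ∀ {n} {G : Graph n} {k} {M : Matrix n} → VanishesBeyond G k M →
    ∀ {U} → Independent G k U →
    quadraticForm M (indicator U) ≈ sum λ i → M i i * indicator U i
  quadraticForm-indicator {M = M} vanish {U} indep =
    trans (quadraticForm-expand M (indicator U)) (sum-cong-≋ λ i →
      trans (sum-cong-≋ (entry i)) (sum-identity i (λ j → M i j * indicator U j)))
    where
    open ≈R
    entry : ∀ i j → M i j * (indicator U i * indicator U j) ≈ identity i j * (M i j * indicator U j)
    entry i j with i ≟ j
    ... | yes ≡.refl with lookup U i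
    ...   | true  = solve 1 (λ m → m :* (con 1 :* con 1) := con 1 :* (m :* con 1)) refl (M i i)
    ...   | false = solve 1 (λ m → m :* (con 0 :* con 0) := con 1 :* (m :* con 0)) refl (M i i)
    entry i j | no i≢j with lookup U i in i∈U | lookup U j in j∈U
    ...   | true  | true  = begin
      M i j * (1# * 1#)        ≈⟨ *-congʳ (vanish i j (indep i j (lookup⇒[]= i U i∈U) (lookup⇒[]= j U j∈U) i≢j)) ⟩
      0# * (1# * 1#)           ≈⟨ R.zeroˡ _ ⟩
      0#                       ≈⟨ R.zeroˡ _ ⟨
      0# * (M i j * 1#)        ∎
    ...   | false | true  = solve 1 (λ m → m :* (con 0 :* con 1) := con 0 :* (m :* con 1)) refl (M i j)
    ...   | _     | false = solve 2 (λ m a → m :* (a :* con 0) := con 0 :* (m :* con 0)) refl (M i j) _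

  -- Bounding the form at the indicator of `U` from below by s a² / n and from above by m a, with m
  -- the largest diagonal entry, leaves s a² ≤ n m a; then a and s are divided out in turn.
  independent-bound : ∀ {n} .{{_ : NonZero n}} {G : Graph n} {k} {M : Matrix n} {s} →
    VanishesBeyond G k M → PositiveSemidefinite M → RowSums M s → 0# < s →
    ∀ {a} → IndependentSize G k a → fromℕ a ≤ fromℕ n / s * max (λ u → M u u)
  independent-bound {n} {G} {k} {M} {s} vanish psd rows 0<s {a} (U , indep , ≡.refl) =
    *-cancelʳ-≤ 0<s (begin
      fromℕ a * s            ≤⟨ a*s≤n*m ⟩
      fromℕ n * m            ≈⟨ *-congʳ (x/y*y≈x (fromℕ n) 0<s) ⟨
      fromℕ n / s * s * m    ≈⟨ solve 3 (λ q s m → q :* s :* m := q :* m :* s) refl (fromℕ n / s) s m ⟩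
      fromℕ n / s * m * s    ∎)
    where
    open ≤R
    m = max (λ u → M u u)
    quadratic : fromℕ a * s * fromℕ a ≤ fromℕ n * m * fromℕ a
    quadratic = begin
      fromℕ a * s * fromℕ a                                ≈⟨ solve 2 (λ a s → a :* s :* a := s :* (a :* a)) refl (fromℕ a) s ⟩
      s * (fromℕ a * fromℕ a)                              ≈⟨ *-congˡ (*-cong (sum-indicator U) (sum-indicator U)) ⟨
      s * (sum (indicator U) * sum (indicator U))          ≤⟨ quadraticForm-lower psd rows (indicator U) ⟩
      fromℕ n * quadraticForm M (indicator U)              ≈⟨ *-congˡ (quadraticForm-indicator {G = G} {k} vanish indep) ⟩
      fromℕ n * (sum λ i → M i i * indicator U i)          ≈⟨ R.*-comm _ _ ⟩
      (sum λ i → M i i * indicator U i) * fromℕ n          ≤⟨ *-monoˡ-≤ (fromℕ-nonneg n) (sum-mono-≤ λ i →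
                                                               *-monoˡ-≤ (indicator-nonneg U i) (max-upper (λ u → M u u) i)) ⟩
      (sum λ i → m * indicator U i) * fromℕ n              ≈⟨ *-congʳ (*-distribˡ-sum m (indicator U)) ⟨
      m * sum (indicator U) * fromℕ n                      ≈⟨ *-congʳ (*-congˡ (sum-indicator U)) ⟩
      m * fromℕ a * fromℕ n                                ≈⟨ solve 3 (λ m a n → m :* a :* n := n :* m :* a) refl m (fromℕ a) (fromℕ n) ⟩
      fromℕ n * m * fromℕ a                                ∎
    0≤n*m : 0# ≤ fromℕ n * m
    0≤n*m = *-nonneg (fromℕ-nonneg n) (max-nonneg (diagonal-nonneg psd))
    divide : ∀ b → fromℕ b * s * fromℕ b ≤ fromℕ n * m * fromℕ b → fromℕ b * s ≤ fromℕ n * m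
    -- An empty set leaves no factor to cancel; the claim is then 0 ≤ n m, which follows from the
    -- nonnegative diagonal.
    divide zero    _ = O.trans (O.reflexive (R.zeroˡ s)) 0≤n*m
    divide (suc b) h = *-cancelʳ-≤ (fromℕ-pos (suc b)) h
    a*s≤n*m : fromℕ a * s ≤ fromℕ n * m
    a*s≤n*m = divide a quadratic

  -- Orthonormal representations and the bound on theta.

  ⟨⟩-affine : ∀ {m} (c u v : Vector Carrier m) a b →
    ⟨ (λ l → c l + a * u l) , (λ l → c l + b * v l) ⟩
    ≈ ⟨ c , c ⟩ + b * ⟨ c , v ⟩ + (a * ⟨ c , u ⟩ + a * b * ⟨ u , v ⟩)
  ⟨⟩-affine {m} c u v a b = begin
    (sum λ l → (c l + a * u l) * (c l + b * v l))
      ≈⟨ sum-cong-≋ (λ l → solve 5 (λ c u v a b →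
           (c :+ a :* u) :* (c :+ b :* v)
           := c :* c :+ b :* (c :* v) :+ (a :* (c :* u) :+ a :* b :* (u :* v))) refl (c l) (u l) (v l) a b) ⟩
    (sum λ l → c l * c l + b * (c l * v l) + (a * (c l * u l) + a * b * (u l * v l)))
      ≈⟨ trans (∑-distrib-+ {m} _ _) (+-cong (∑-distrib-+ {m} _ _) (∑-distrib-+ {m} _ _)) ⟩
    ⟨ c , c ⟩ + (sum λ l → b * (c l * v l)) + ((sum λ l → a * (c l * u l)) + (sum λ l → a * b * (u l * v l)))
      ≈⟨ +-cong (+-congˡ (*-distribˡ-sum {m} _ _)) (+-cong (*-distribˡ-sum {m} _ _) (*-distribˡ-sum {m} _ _)) ⟨
    ⟨ c , c ⟩ + b * ⟨ c , v ⟩ + (a * ⟨ c , u ⟩ + a * b * ⟨ u , v ⟩) ∎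
    where open ≈R

  -- The vector `w i` is `b i` times `u i` minus its projection onto `c`, so the Gram matrix of `w`
  -- is that of the scaled `u i` minus the all-ones matrix. By `compat`, the entrywise product of
  -- `M` with the Gram matrix of `u` is the diagonal part of `M`, so only diagonal terms remain once
  -- the sum of all entries is added back.
  sum-entries-≤ : ∀ {n m} {M : Matrix n} → PositiveSemidefinite M →
    (u : Fin n → Vector Carrier m) → (∀ i j → M i j * ⟨ u i , u j ⟩ ≈ identity i j * M i j) →
    (c : Vector Carrier m) → Unit c →
    (b : Vector Carrier n) → (∀ i → b i * ⟨ c , u i ⟩ ≈ - 1#) →
    (sum λ i → sum λ j → M i j) ≤ sum λ i → b i * b i * M i i
  sum-entries-≤ {n} {m} {M} psd u compat c unit b b-inv = begin
    (sum λ i → sum λ j → M i j)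
      ≈⟨ R.+-identityˡ _ ⟨
    0# + (sum λ i → sum λ j → M i j)
      ≤⟨ +-monoˡ-≤ _ (gram-nonneg psd w) ⟩
    (sum λ i → sum λ j → M i j * ⟨ w i , w j ⟩) + (sum λ i → sum λ j → M i j)
      ≈⟨ trans (sum-cong-≋ {n} λ i → ∑-distrib-+ {n} _ _) (∑-distrib-+ {n} _ _) ⟨
    (sum λ i → sum λ j → M i j * ⟨ w i , w j ⟩ + M i j)
      ≈⟨ sum-cong-≋ (λ i → trans (sum-cong-≋ (entry i)) (sum-identity i _)) ⟩
    (sum λ i → b i * b i * M i i) ∎
    where
    open ≤R
    w : Fin n → Vector Carrier m
    w i l = c l + b i * u i l
    entry : ∀ i j → M i j * ⟨ w i , w j ⟩ + M i j ≈ identity i j * (b i * b j * M i j)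
    entry i j = ≈R.begin
      M i j * ⟨ w i , w j ⟩ + M i j
        ≈R.≈⟨ +-congʳ (*-congˡ (trans (⟨⟩-affine c (u i) (u j) (b i) (b j))
               (+-cong (+-cong unit (b-inv j)) (+-congʳ (b-inv i))))) ⟩
      M i j * (1# + - 1# + (- 1# + b i * b j * ⟨ u i , u j ⟩)) + M i j
        -- Here `e` stands for -1; the four constant multiples of `M i j` pair up into two copies of
        -- `1# + - 1#`.
        ≈R.≈⟨ solve 5 (λ m e a b g → m :* (con 1 :+ e :+ (e :+ a :* b :* g)) :+ m
                        := a :* b :* (m :* g) :+ (m :+ m) :* (con 1 :+ e)) refl (M i j) (- 1#) (b i) (b j) ⟨ u i , u j ⟩ ⟩
      b i * b j * (M i j * ⟨ u i , u j ⟩) + (M i j + M i j) * (1# + - 1#)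
        ≈R.≈⟨ +-cong (*-congˡ (compat i j)) (*-congˡ (R.-‿inverseʳ 1#)) ⟩
      b i * b j * (identity i j * M i j) + (M i j + M i j) * 0#
        ≈R.≈⟨ solve 4 (λ m a b δ → a :* b :* (δ :* m) :+ (m :+ m) :* con 0
                        := δ :* (a :* b :* m)) refl (M i j) (b i) (b j) (identity i j) ⟩
      identity i j * (b i * b j * M i j) ≈R.∎

  -x⁻¹*x≈-1 : ∀ {x} → ¬ x ≈ 0# → - (x ⁻¹) * x ≈ - 1#
  -x⁻¹*x≈-1 {x} x≉0 = trans (sym (-‿distribˡ-* (x ⁻¹) x))
    (R.-‿cong (trans (R.*-comm _ x) (⁻¹-inverseʳ x x≉0)))

  -- Squaring the hypothesis gives b² x² = 1, which also shows that `x ^ 2` is invertible.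
  square-reciprocal : ∀ {x b} → b * x ≈ - 1# → b * b ≈ 1# / x ^ 2
  square-reciprocal {x} {b} bx≈-1 = *-cancelʳ x²≉0 (begin
    b * b * x ^ 2        ≈⟨ b²x²≈1 ⟩
    1#                   ≈⟨ ⁻¹-inverseʳ _ x²≉0 ⟨
    x ^ 2 * (x ^ 2) ⁻¹   ≈⟨ solve 2 (λ y z → y :* z := con 1 :* z :* y) refl (x ^ 2) ((x ^ 2) ⁻¹) ⟩
    1# / x ^ 2 * x ^ 2   ∎)
    where
    open ≈R
    b²x²≈1 : b * b * x ^ 2 ≈ 1#
    b²x²≈1 = begin
      b * b * (x * (x * 1#)) ≈⟨ *-congˡ (*-congˡ (R.*-identityʳ x)) ⟩
      b * b * (x * x)        ≈⟨ solve 2 (λ b x → b :* b :* (x :* x) := b :* x :* (b :* x)) refl b x ⟩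
      b * x * (b * x)        ≈⟨ *-cong bx≈-1 bx≈-1 ⟩
      - 1# * - 1#            ≈⟨ -1*-1≈1 ⟩
      1#                     ∎
    x²≉0 : ¬ x ^ 2 ≈ 0#
    x²≉0 x²≈0 = 1≉0 (trans (sym b²x²≈1) (trans (*-congˡ x²≈0) (R.zeroʳ _)))

  -- In `sum-entries-≤` the left side is n s, and the right side is at most r times the trace,
  -- because each `b i * b i` is one of the reciprocals whose maximum is `r`. The bound holds for
  -- every handle `c`, not just an optimal one.
  cost-bound : ∀ {n m} .{{_ : NonZero n}} {M : Matrix n} {s} →
    PositiveSemidefinite M → RowSums M s → 0# < s →
    (u : Fin n → Vector Carrier m) → (∀ i j → M i j * ⟨ u i , u j ⟩ ≈ identity i j * M i j) →
    ∀ {r} → Cost u r → fromℕ n * s / tr M ≤ r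
  cost-bound {n} {M = M} {s} psd rows 0<s u compat {r} (c , unit , c·u≉0 , r≈max) =
    *-cancelʳ-≤ 0<tr (O.trans (O.reflexive (x/y*y≈x _ 0<tr)) ns≤r*tr)
    where
    open ≤R
    b : Vector Carrier n
    b i = - (⟨ c , u i ⟩ ⁻¹)
    b-inv : ∀ i → b i * ⟨ c , u i ⟩ ≈ - 1#
    b-inv i = -x⁻¹*x≈-1 (c·u≉0 i)
    b²≤r : ∀ i → b i * b i ≤ r
    b²≤r i = begin
      b i * b i                            ≈⟨ square-reciprocal (b-inv i) ⟩
      1# / ⟨ c , u i ⟩ ^ 2                 ≤⟨ max-upper (λ i → 1# / ⟨ c , u i ⟩ ^ 2) i ⟩
      max (λ i → 1# / ⟨ c , u i ⟩ ^ 2)     ≈⟨ r≈max ⟨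
      r                                    ∎
    ns≤r*tr : fromℕ n * s ≤ r * tr M
    ns≤r*tr = begin
      fromℕ n * s                          ≈⟨ sum-const n s ⟨
      (sum {n} λ _ → s)                    ≈⟨ sum-cong-≋ rows ⟨
      (sum λ i → sum λ j → M i j)          ≤⟨ sum-entries-≤ psd u compat c unit b b-inv ⟩
      (sum λ i → b i * b i * M i i)        ≤⟨ sum-mono-≤ (λ i → *-monoˡ-≤ (diagonal-nonneg psd i) (b²≤r i)) ⟩
      (sum λ i → r * M i i)                ≈⟨ *-distribˡ-sum r (λ i → M i i) ⟨
      r * tr M                             ∎
    0<ns : 0# < fromℕ n * s
    0<ns = *-pos (fromℕ-pos n) 0<s
    -- A zero trace would turn the inequality above into n s ≤ 0, so the denominator is positive.
    0<tr : 0# < tr M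
    0<tr = sum-nonneg (diagonal-nonneg psd) , λ 0≈tr → proj₂ 0<ns (O.antisym (proj₁ 0<ns)
      (O.trans ns≤r*tr (O.reflexive (trans (*-congˡ (sym 0≈tr)) (R.zeroʳ r)))))

  -- Distinct vertices within distance `k` are nonadjacent in the complement of the power graph, so
  -- their vectors are orthogonal; beyond distance `k` the matrix entry is zero instead.
  entries-compatible : ∀ {n m} {G : Graph n} {k} {M : Matrix n} → VanishesBeyond G k M →
    (u : OrthonormalRep (complement (power G k)) m) →
    ∀ i j → M i j * ⟨ OrthonormalRep.vec u i , OrthonormalRep.vec u j ⟩ ≈ identity i j * M i j
  entries-compatible {G = G} {k} {M} vanish u i j with i ≟ j
  ... | yes ≡.refl = trans (R.*-comm _ _) (*-congʳ (OrthonormalRep.unit u i))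
  ... | no  i≢j with d≤? G i j k
  ...   | yes d≤k = begin
    M i j * ⟨ vec i , vec j ⟩   ≈⟨ *-congˡ (orthogonal i j i≢j λ (_ , ¬adj) → ¬adj (i≢j , d≤k)) ⟩
    M i j * 0#                  ≈⟨ R.zeroʳ _ ⟩
    0#                          ≈⟨ R.zeroˡ _ ⟨
    0# * M i j                  ∎
    where
    open OrthonormalRep u
    open ≈R
  ...   | no  d>k = trans (*-congʳ (vanish i j d>k)) (trans (R.zeroˡ _) (sym (R.zeroˡ _)))

  -- Row sums and zero patterns of matrix polynomials.

  module _ {n} {A : Matrix n} where

    -- The all-ones vector is an eigenvector of `A` for `d`, hence of each power of `A` for the same
    -- power of `d`.
    ^ᴹ-rowSums : ∀ {d} → RowSums A d → ∀ m → RowSums (A ^ᴹ m) (d ^ m)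
    ^ᴹ-rowSums rows zero i = trans (sum-cong-≋ λ j → sym (R.*-identityʳ (identity i j)))
      (sum-identity i (λ _ → 1#))
    ^ᴹ-rowSums {d} rows (suc m) i = begin
      (sum λ j → sum λ l → A i l * (A ^ᴹ m) l j) ≈⟨ ∑-comm {n} {n} _ ⟩
      (sum λ l → sum λ j → A i l * (A ^ᴹ m) l j) ≈⟨ sum-cong-≋ (λ l → *-distribˡ-sum (A i l) ((A ^ᴹ m) l)) ⟨
      (sum λ l → A i l * sum ((A ^ᴹ m) l))       ≈⟨ sum-cong-≋ (λ l → *-congˡ (^ᴹ-rowSums rows m l)) ⟩
      (sum λ l → A i l * d ^ m)                  ≈⟨ *-distribʳ-sum (d ^ m) (A i) ⟨
      sum (A i) * d ^ m                          ≈⟨ *-congʳ (rows i) ⟩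
      d * d ^ m                                  ∎
      where open ≈R

    evalᴹ-rowSums : ∀ {d k} (p : Polynomial≤ k) → RowSums A d → RowSums (evalᴹ p A) (eval p d)
    evalᴹ-rowSums {d} {k} p rows u = begin
      (sum λ v → sum λ i → p i * (A ^ᴹ toℕ i) u v) ≈⟨ ∑-comm {n} {suc k} (λ v i → p i * (A ^ᴹ toℕ i) u v) ⟩
      (sum λ i → sum λ v → p i * (A ^ᴹ toℕ i) u v) ≈⟨ sum-cong-≋ (λ i → *-distribˡ-sum (p i) ((A ^ᴹ toℕ i) u)) ⟨
      (sum λ i → p i * sum ((A ^ᴹ toℕ i) u))       ≈⟨ sum-cong-≋ {suc k} (λ i → *-congˡ {p i} (^ᴹ-rowSums rows (toℕ i) u)) ⟩
      eval p d                                     ∎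
      where open ≈R

    module _ {G : Graph n} (A-vanish : VanishesBeyond G 1 A) where

      -- A nonzero term of the product needs an intermediate vertex `l` within distance 1 of `i` and
      -- `m` of `j`; joining the walks would put `j` within `suc m` of `i`.
      ^ᴹ-vanishes : ∀ m → VanishesBeyond G m (A ^ᴹ m)
      ^ᴹ-vanishes zero    i j d>0 = identity-off-diagonal {i = i} {j} λ { ≡.refl → d>0 (0 , z≤n , []) }
      ^ᴹ-vanishes (suc m) i j d>m = sum-zero term
        where
        extend : ∀ {l} → d⟨_,_⟩≤_ G i l 1 → d⟨_,_⟩≤_ G l j m → d⟨_,_⟩≤_ G i j (suc m)
        -- The diagonal of `A` is arbitrary, so the first step may stay at `i`; the bound `m` is
        -- then relaxed to `suc m`.
        extend (0 , _ , [])          (q , q≤m , w) = q , ℕ.m≤n⇒m≤1+n q≤m , w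
        extend (1 , _ , adj ∷ [])    (q , q≤m , w) = suc q , s≤s q≤m , adj ∷ w
        extend (suc (suc _) , s≤s () , _) _
        term : ∀ l → A i l * (A ^ᴹ m) l j ≈ 0#
        term l with d≤? G i l 1
        ... | yes d≤1 = trans (*-congˡ (^ᴹ-vanishes m l j λ d≤m → d>m (extend d≤1 d≤m))) (R.zeroʳ _)
        ... | no  d>1 = trans (*-congʳ (A-vanish i l d>1)) (R.zeroˡ _)

      evalᴹ-vanishes : ∀ {k} (p : Polynomial≤ k) → VanishesBeyond G k (evalᴹ p A)
      evalᴹ-vanishes p u v d>k = sum-zero λ i → trans
        -- The index runs over the k + 1 coefficients, so the exponent `toℕ i` is at most `k`.
        (*-congˡ (^ᴹ-vanishes (toℕ i) u v λ (m , m≤i , w) → d>k (m , ℕ.≤-trans m≤i (toℕ≤pred[n] i) , w)))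
        (R.zeroʳ (p i))

theorem8 : ∀ {c ℓ₁ ℓ₂} (ℝ : CompleteOrderedField c ℓ₁ ℓ₂) →
    let open CompleteOrderedField ℝ
        open RealMatrices ℝ
    in
    (k : ℕ) .{{_ : NonZero k}} (n : ℕ) .{{_ : NonZero n}} (G : Graph n)
    (A : Matrix n) → 𝒮 G A →
    (d : Carrier) → RowSums A d →
    (p : Polynomial≤ k) → PositiveSemidefinite (evalᴹ p A) → 0# < eval p d →
    (fromℕ (α G k) ≤ fromℕ n / eval p d * max (λ u → evalᴹ p A u u))
    × (∀ ϑ → Is-ϑ (complement (power G k)) ϑ →
         fromℕ n * eval p d / tr (evalᴹ p A) ≤ ϑ)
theorem8 ℝ k n G A (_ , A-vanish) d rows p psd 0<pd =
    independent-bound ℝ {G = G} {k} vanish psd rowsᵖ 0<pd (proj₁ (proj₂ (maxIndependentSize G k)))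
  -- Both nested minima are attained, so `ϑ` is itself the cost of some representation with some
  -- handle, and bounding every cost suffices.
  , λ { ϑ ((_ , u , cost , _) , _) →
        cost-bound ℝ psd rowsᵖ 0<pd (OrthonormalRep.vec u) (entries-compatible ℝ {G = G} vanish u) cost }
  where
  open RealMatrices ℝ
  vanish = evalᴹ-vanishes ℝ {A = A} {G} A-vanish p
  rowsᵖ  = evalᴹ-rowSums ℝ {A = A} p rows
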